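{- Let $\varepsilon$ be a real number with $0\le\varepsilon\le 1$. If $G$ is a graph in which every vertex has even degree, then $G$ admits an even factor $F$ such that for each vertex $v$, $|d_F(v)-\varepsilon d_G(v)|<2$.
   Context: Graphs are finite and may have loops and multiple edges; a loop contributes $2$ to the degree. An even factor is a spanning subgraph in which every vertex has even degree. -}

module Defs where

open import Level using (0ℓ)
open import Data.Nat using (ℕ; zero; suc; _+_)
open import Data.Nat.Divisibility using (_∣_)
open import Data.Fin using (Fin; _≟_)
import Data.Fin as Fin
open import Data.Bool using (Bool; true; false)
open import Data.Product using (_×_; _,_; proj₁; proj₂; Σ; ∃)
open import Data.Sum using (_⊎_)
open import Data.Integer using (+_)
open import Data.Rational using (ℚ; _/_; _<_; _*_; _-_; 0ℚ; 1ℚ) renaming (_+_ to _+ℚ_)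
open import Relation.Nullary using (¬_; yes; no)
open import Function.Bundles using (_⇔_)

record ℝ : Set₁ where
  field
    L : ℚ → Set
    U : ℚ → Set
    L-inhabited : ∃ L
    U-inhabited : ∃ U
    L-rounded : ∀ q → L q ⇔ ∃ (λ r → q < r × L r)
    U-rounded : ∀ q → U q ⇔ ∃ (λ r → r < q × U r)
    disjoint  : ∀ q → ¬ (L q × U q)
    located   : ∀ q r → q < r → L q ⊎ U r

open ℝ public

ℕ→ℚ : ℕ → ℚ
ℕ→ℚ n = + n / 1

0≤ : ℝ → Set
0≤ x = ∀ q → U x q → 0ℚ < q

≤1 : ℝ → Set
≤1 x = ∀ q → L x q → q < 1ℚ

-- |a - x·d| < 2  for naturals a, d and a real x, i.e.
--   a - 2 < x·d   and   x·d < a + 2,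
-- where (q < x·d ⇔ ∃ r ∈ L x, q < r·d) and (x·d < q ⇔ ∃ s ∈ U x, s·d < q)
-- (valid for all d, including d = 0, since the cuts are rounded).
dist<2 : ℕ → ℝ → ℕ → Set
dist<2 a x d =
  ∃ (λ r → L x r × (ℕ→ℚ a - ℕ→ℚ 2) < (r * ℕ→ℚ d))
  × ∃ (λ s → U x s × (s * ℕ→ℚ d) < (ℕ→ℚ a +ℚ ℕ→ℚ 2))

-- Finite multigraphs with loops: n vertices, m edges, each edge has
-- two (possibly equal) endpoints.

record Graph : Set where
  field
    nV : ℕ
    nE : ℕ
    ends : Fin nE → Fin nV × Fin nV

open Graph public

-- number of endpoints of an edge equal to v (a loop at v counts 2)
incidence : {n : ℕ} → Fin n × Fin n → Fin n → ℕ
incidence (a , b) v = hit a + hit b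
  where
  hit : _ → ℕ
  hit u with u ≟ v
  ... | yes _ = 1
  ... | no  _ = 0

sumFin : (m : ℕ) → (Fin m → ℕ) → ℕ
sumFin zero    f = 0
sumFin (suc m) f = f Fin.zero + sumFin m (λ i → f (Fin.suc i))

SpanningSubgraph : Graph → Set
SpanningSubgraph G = Fin (nE G) → Bool

deg : (G : Graph) → Fin (nV G) → ℕ
deg G v = sumFin (nE G) (λ e → incidence (ends G e) v)

degIn : (G : Graph) → SpanningSubgraph G → Fin (nV G) → ℕ
degIn G F v = sumFin (nE G) (λ e → keep (F e) e)
  where
  keep : Bool → Fin (nE G) → ℕ
  keep true  e = incidence (ends G e) v
  keep false e = 0

Even : ℕ → Set
Even k = 2 ∣ k

IsEvenFactor : (G : Graph) → SpanningSubgraph G → Set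
IsEvenFactor G F = ∀ v → Even (degIn G F v)

{-# OPTIONS --safe #-}

-- An orientation of G with equal in- and out-degrees m(v) = d(v)/2 turns the constant function ε
-- into a circulation with throughput ε m(v) at v.  An integral circulation with values in {0,1} and
-- throughput the floor or the ceiling of ε m(v) is an even factor F with d_F(v) twice that throughput.
--
-- Rounding: for a circulation with values in 2^-k ℤ, the arcs whose numerator is odd form an even
-- graph; adding ± 2^-k along a balanced orientation of it gives values in 2^-(k-1) ℤ, and never
-- crosses an integer.  The sign may be chosen so that a given linear functional does not decrease.
--
-- If ε m(v) is an integer, F must attain it exactly, while a dyadic c/2^k just below ε only gives
-- ε m(v) or ε m(v) - 1.  Maximising the total throughput of these vertices forces equality, once 2^k
-- is so large that their total deficit stays below 1 (a device of Alon).
--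
-- A real ε is first replaced by a rational one: only its position relative to finitely many
-- rational thresholds matters, and a located cut suffices to find a rational in the same position.
module Submission where

open import Defs
open import Algebra.Properties.Semiring.Sum as SumProperties using ()
open import Data.Bool using (Bool; true; false; if_then_else_)
open import Data.Empty using (⊥-elim)
open import Data.Fin using (Fin; zero; suc; _↑ˡ_; _↑ʳ_) renaming (_≟_ to _≟ᶠ_)
open import Data.Fin.Properties using (any?)
open import Data.Integer hiding (suc; _/_; _%_)
open import Data.Integer.Divisibility.Signed
open import Data.Integer.DivMod using (_/_; _%_; n%d<d; a≡a%n+[a/n]*n; _/ℕ_; [n/ℕd]*d≤n; n<s[n/ℕd]*d; 0≤n⇒0≤n/ℕd)
open import Data.Integer.Properties
open import Data.Integer.Tactic.RingSolver using (solve-∀)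
open import Data.List using (List; []; _∷_; upTo; cartesianProductWith)
open import Data.List.Membership.Propositional using (_∈_)
open import Data.List.Membership.Propositional.Properties using (∈-cartesianProductWith⁺; ∈-upTo⁺)
open import Data.List.Relation.Unary.All as All using (All; []; _∷_)
open import Data.List.Relation.Unary.Any using (here; there)
open import Data.Nat as ℕ using (ℕ; zero; suc)
import Data.Nat.Properties as ℕ
open import Data.Product using (Σ; ∃; _×_; _,_; proj₁; proj₂)
open import Data.Rational as ℚ using (ℚ; 0ℚ; 1ℚ; toℚᵘ)
import Data.Rational.Properties as ℚ
open import Data.Rational.Unnormalised as ℚᵘ using (mkℚᵘ; *≡*)
import Data.Rational.Unnormalised.Properties as ℚᵘ
open import Data.Sum using (_⊎_; inj₁; inj₂)
open import Data.Sum.Properties using (≡-dec)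
open import Data.Vec.Functional using (updateAt; _++_)
open import Data.Vec.Functional.Properties using (updateAt-updates; updateAt-minimal; lookup-++ˡ; lookup-++ʳ)
open import Function using (_∘_; const)
open import Function.Bundles using (Equivalence)
open import Relation.Binary.Definitions using (DecidableEquality; Tri; tri<; tri≈; tri>)
open import Relation.Binary.PropositionalEquality
open import Relation.Nullary using (¬_; Dec; yes; no; does; ¬?)
open import Relation.Nullary.Decidable using (decidable-stable; from-no; dec-true; dec-false)

open SumProperties +-*-semiring

2ℤ : ℤ
2ℤ = + 2

-- Finite sums of integers

sum-zero : ∀ {n} {f : Fin n → ℤ} → (∀ i → f i ≡ 0ℤ) → sum f ≡ 0ℤ
sum-zero {n} f≗0 = trans (sum-cong-≗ f≗0) (sum-replicate-zero n)

sum-≢0 : ∀ {n} {f : Fin n → ℤ} → sum f ≢ 0ℤ → ∃ λ i → f i ≢ 0ℤ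
sum-≢0 {f = f} ∑f≢0 with any? (λ i → ¬? (f i ≟ 0ℤ))
... | yes found = found
... | no  none  = ⊥-elim (∑f≢0 (sum-zero λ i → decidable-stable (f i ≟ 0ℤ) λ fi≢0 → none (i , fi≢0)))

sum-perturb : ∀ {n} (f g : Fin n → ℤ) (i : Fin n) d →
  g i ≡ f i + d → (∀ j → j ≢ i → g j ≡ f j) → sum g ≡ sum f + d
sum-perturb f g zero d at-i away = begin
  g zero + sum (g ∘ suc)         ≡⟨ cong₂ _+_ at-i (sum-cong-≗ λ j → away (suc j) λ ()) ⟩
  (f zero + d) + sum (f ∘ suc)   ≡⟨ swap (f zero) d (sum (f ∘ suc)) ⟩
  (f zero + sum (f ∘ suc)) + d   ∎
  where
  open ≡-Reasoning
  swap : ∀ a b c → (a + b) + c ≡ (a + c) + b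
  swap = solve-∀
sum-perturb f g (suc i) d at-i away = begin
  g zero + sum (g ∘ suc)         ≡⟨ cong₂ _+_ (away zero λ ()) (sum-perturb (f ∘ suc) (g ∘ suc) i d at-i
                                      λ j j≢i → away (suc j) λ { refl → j≢i refl }) ⟩
  f zero + (sum (f ∘ suc) + d)   ≡⟨ +-assoc (f zero) (sum (f ∘ suc)) d ⟨
  (f zero + sum (f ∘ suc)) + d   ∎
  where open ≡-Reasoning

∣-sum : ∀ {n} k (f : Fin n → ℤ) → (∀ i → k ∣ f i) → k ∣ sum f
∣-sum {zero}  k f k∣f = divides 0ℤ refl
∣-sum {suc n} k f k∣f = ∣m∣n⇒∣m+n (k∣f zero) (∣-sum k (f ∘ suc) (k∣f ∘ suc))

_·_ : ∀ {n} → (Fin n → ℤ) → (Fin n → ℤ) → ℤ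
f · x = sum (λ i → f i * x i)

·-+ : ∀ {n} (f g x : Fin n → ℤ) → (λ i → f i + g i) · x ≡ f · x + g · x
·-+ f g x = trans (sum-cong-≗ λ i → *-distribʳ-+ (x i) (f i) (g i)) (∑-distrib-+ (λ i → f i * x i) (λ i → g i * x i))

·-*ˡ : ∀ {n} c (f x : Fin n → ℤ) → (λ i → c * f i) · x ≡ c * (f · x)
·-*ˡ c f x = trans (sum-cong-≗ λ i → *-assoc c (f i) (x i)) (sym (*-distribˡ-sum c (λ i → f i * x i)))

IsUnit : ℤ → Set
IsUnit u = u ≡ 1ℤ ⊎ u ≡ -1ℤ

IsUnit-* : ∀ {u v} → IsUnit u → IsUnit v → IsUnit (u * v)
IsUnit-* (inj₁ refl) (inj₁ refl) = inj₁ refl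
IsUnit-* (inj₁ refl) (inj₂ refl) = inj₂ refl
IsUnit-* (inj₂ refl) (inj₁ refl) = inj₂ refl
IsUnit-* (inj₂ refl) (inj₂ refl) = inj₁ refl

IsUnit⇒2∣1-u : ∀ {u} → IsUnit u → 2ℤ ∣ 1ℤ - u
IsUnit⇒2∣1-u (inj₁ refl) = divides 0ℤ refl
IsUnit⇒2∣1-u (inj₂ refl) = divides 1ℤ refl

odd+unit : ∀ {i u} → ¬ (2ℤ ∣ i) → IsUnit u → 2ℤ ∣ i + u
odd+unit {i} {u} 2∤i u-unit with i % 2ℤ | a≡a%n+[a/n]*n i 2ℤ | n%d<d i 2ℤ
... | 0 | eq | _ = ⊥-elim (2∤i (divides (i / 2ℤ) (trans eq (+-identityˡ _))))
... | 1 | eq | _ = subst (2ℤ ∣_) (trans (regroup (i / 2ℤ) u) (cong (_+ u) (sym eq)))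
    (∣m∣n⇒∣m-n (divides (1ℤ + i / 2ℤ) refl) (IsUnit⇒2∣1-u u-unit))
  where
  regroup : ∀ q u → (1ℤ + q) * 2ℤ - (1ℤ - u) ≡ (1ℤ + q * 2ℤ) + u
  regroup = solve-∀
... | ℕ.suc (ℕ.suc _) | _ | ℕ.s<s (ℕ.s<s ())

-- Balanced orientations of even graphs

module Circulations {V : Set} (_≟ᵛ_ : DecidableEquality V) where

  δ : V → V → ℤ
  δ u v = if does (u ≟ᵛ v) then 1ℤ else 0ℤ

  δ-refl : ∀ v → δ v v ≡ 1ℤ
  δ-refl v rewrite dec-true (v ≟ᵛ v) refl = refl

  δ-≢ : ∀ {u v} → u ≢ v → δ u v ≡ 0ℤ
  δ-≢ {u} {v} u≢v rewrite dec-false (u ≟ᵛ v) u≢v = refl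

  -- Modulo 2 this is the contribution of the arc to the degree of `v`, whichever way the arc
  -- points; a loop contributes 0.
  ∂ : V × V → V → ℤ
  ∂ (a , b) v = δ b v - δ a v

  ∂-loop : ∀ {a b} → a ≡ b → ∀ v → ∂ (a , b) v ≡ 0ℤ
  ∂-loop {a} refl v = +-inverseʳ (δ a v)

  -- Exactly one end of `arc` is `b`. If it is the tail, the path from `a` through `b` is shortcut
  -- and `σ` is 1; if it is the head, the arc from `a` to `b` has to be traversed backwards and `σ`
  -- is -1.
  splice : ∀ a b arc → ∂ arc b ≢ 0ℤ →
    ∃ λ σ → ∃ λ arc′ → IsUnit σ × (∀ v → ∂ arc′ v ≡ ∂ arc v + σ * ∂ (a , b) v)
  splice a b (s , t) ∂b≢0 with s ≟ᵛ b | t ≟ᵛ b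
  ... | yes refl | _ = 1ℤ , (a , t) , inj₁ refl , λ v → lemma (δ a v) (δ b v) (δ t v)
    where
    lemma : ∀ a b t → t - a ≡ (t - b) + 1ℤ * (b - a)
    lemma = solve-∀
  ... | no _ | yes refl = -1ℤ , (s , a) , inj₂ refl , λ v → lemma (δ a v) (δ b v) (δ s v)
    where
    lemma : ∀ a b s → a - s ≡ (b - s) + -1ℤ * (b - a)
    lemma = solve-∀
  ... | no s≢b | no t≢b = ⊥-elim (∂b≢0 refl)

  -- Splitting off: if arc 0 runs from a to b, then some other arc has an end at b; the two are
  -- replaced by a single arc that bypasses b, and arc 0 inherits its sign from that arc.
  balanced-signs : ∀ m (arc : Fin m → V × V) → (∀ v → 2ℤ ∣ sum (λ e → ∂ (arc e) v)) →
    ∃ λ s → (∀ e → IsUnit (s e)) × (∀ v → sum (λ e → s e * ∂ (arc e) v) ≡ 0ℤ)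
  balanced-signs zero    arc even = (λ ()) , (λ ()) , λ _ → refl
  balanced-signs (suc m) arc even with proj₁ (arc zero) ≟ᵛ proj₂ (arc zero)
  ... | yes a≡b = s , unit , balanced
    where
    rest : ∃ λ s → (∀ e → IsUnit (s e)) × (∀ v → sum (λ e → s e * ∂ (arc (suc e)) v) ≡ 0ℤ)
    rest = balanced-signs m (arc ∘ suc) λ v →
      subst (2ℤ ∣_) (trans (cong (_+ sum (λ e → ∂ (arc (suc e)) v)) (∂-loop a≡b v)) (+-identityˡ _)) (even v)
    s : Fin (suc m) → ℤ
    s zero    = 1ℤ
    s (suc e) = proj₁ rest e
    unit : ∀ e → IsUnit (s e)
    unit zero    = inj₁ refl
    unit (suc e) = proj₁ (proj₂ rest) e
    balanced : ∀ v → sum (λ e → s e * ∂ (arc e) v) ≡ 0ℤ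
    balanced v = cong₂ _+_ (trans (*-identityˡ _) (∂-loop a≡b v))
                           (proj₂ (proj₂ rest) v)
  ... | no a≢b = s , unit , balanced
    where
    a b : V
    a = proj₁ (arc zero)
    b = proj₂ (arc zero)
    -- Otherwise arc 0 alone would determine the boundary at `b`, which would be 1 and hence odd.
    tail-sum-≢0 : sum (λ e → ∂ (arc (suc e)) b) ≢ 0ℤ
    tail-sum-≢0 ∑≡0 = 2∤1 (subst (2ℤ ∣_) ∑≡1 (even b))
      where
      2∤1 : ¬ (2ℤ ∣ 1ℤ)
      2∤1 = from-no (2ℤ ∣? 1ℤ)
      ∑≡1 : ∂ (a , b) b + sum (λ e → ∂ (arc (suc e)) b) ≡ 1ℤ
      ∑≡1 = cong₂ _+_ (cong₂ _-_ (δ-refl b) (δ-≢ a≢b)) ∑≡0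

    other : ∃ λ i → ∂ (arc (suc i)) b ≢ 0ℤ
    other = sum-≢0 tail-sum-≢0
    i : Fin m
    i = proj₁ other
    spliced : ∃ λ σ → ∃ λ arc′ → IsUnit σ × (∀ v → ∂ arc′ v ≡ ∂ (arc (suc i)) v + σ * ∂ (a , b) v)
    spliced = splice a b (arc (suc i)) (proj₂ other)
    σ : ℤ
    σ = proj₁ spliced
    σ-unit : IsUnit σ
    σ-unit = proj₁ (proj₂ (proj₂ spliced))
    arc′ : Fin m → V × V
    arc′ = updateAt (arc ∘ suc) i (const (proj₁ (proj₂ spliced)))

    ∂arc′-at : ∀ v → ∂ (arc′ i) v ≡ ∂ (arc (suc i)) v + σ * ∂ (a , b) v
    ∂arc′-at v = trans (cong (λ x → ∂ x v) (updateAt-updates i (arc ∘ suc)))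
                       (proj₂ (proj₂ (proj₂ spliced)) v)
    ∂arc′-away : ∀ v j → j ≢ i → ∂ (arc′ j) v ≡ ∂ (arc (suc j)) v
    ∂arc′-away v j j≢i = cong (λ x → ∂ x v) (updateAt-minimal j i (arc ∘ suc) j≢i)

    -- Splicing turns the contribution of arc 0 from `∂ (a , b) v` into `σ * ∂ (a , b) v`, a change
    -- by an even amount.
    even′ : ∀ v → 2ℤ ∣ sum (λ e → ∂ (arc′ e) v)
    even′ v = subst (2ℤ ∣_) (sym eq) (∣m∣n⇒∣m-n (even v) (∣m⇒∣m*n (∂ (a , b) v) (IsUnit⇒2∣1-u σ-unit)))
      where
      regroup : ∀ S d u → S + u * d ≡ (d + S) - (1ℤ - u) * d
      regroup = solve-∀
      eq : sum (λ e → ∂ (arc′ e) v) ≡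
           (∂ (a , b) v + sum (λ e → ∂ (arc (suc e)) v)) - (1ℤ - σ) * ∂ (a , b) v
      eq = trans (sum-perturb (λ e → ∂ (arc (suc e)) v) (λ e → ∂ (arc′ e) v) i (σ * ∂ (a , b) v)
                    (∂arc′-at v) (∂arc′-away v))
                 (regroup (sum (λ e → ∂ (arc (suc e)) v)) (∂ (a , b) v) σ)

    rest : ∃ λ s → (∀ e → IsUnit (s e)) × (∀ v → sum (λ e → s e * ∂ (arc′ e) v) ≡ 0ℤ)
    rest = balanced-signs m arc′ even′
    s′ : Fin m → ℤ
    s′ = proj₁ rest
    s : Fin (suc m) → ℤ
    s zero    = σ * s′ i
    s (suc e) = s′ e
    unit : ∀ e → IsUnit (s e)
    unit zero    = IsUnit-* σ-unit (proj₁ (proj₂ rest) i)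
    unit (suc e) = proj₁ (proj₂ rest) e
    balanced : ∀ v → sum (λ e → s e * ∂ (arc e) v) ≡ 0ℤ
    balanced v = begin
      σ * s′ i * ∂ (a , b) v + S      ≡⟨ +-comm _ S ⟩
      S + σ * s′ i * ∂ (a , b) v
        ≡⟨ sum-perturb (λ e → s′ e * ∂ (arc (suc e)) v) (λ e → s′ e * ∂ (arc′ e) v) i _
             (trans (cong (s′ i *_) (∂arc′-at v)) (expand (s′ i) (∂ (arc (suc i)) v) σ (∂ (a , b) v)))
             (λ j j≢i → cong (s′ j *_) (∂arc′-away v j j≢i)) ⟨
      sum (λ e → s′ e * ∂ (arc′ e) v) ≡⟨ proj₂ (proj₂ rest) v ⟩
      0ℤ                              ∎
      where
      open ≡-Reasoning
      S : ℤ
      S = sum (λ e → s′ e * ∂ (arc (suc e)) v)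
      expand : ∀ x d u d₀ → x * (d + u * d₀) ≡ x * d + u * x * d₀
      expand = solve-∀

-- Rounding of circulations

0≤-+ : ∀ {i j} → 0ℤ ≤ i → 0ℤ ≤ j → 0ℤ ≤ i + j
0≤-+ = +-mono-≤

0≤-* : ∀ {i j} → 0ℤ ≤ i → 0ℤ ≤ j → 0ℤ ≤ i * j
0≤-* {i} {j} 0≤i 0≤j = subst (_≤ i * j) (*-zeroʳ i) (*-monoˡ-≤-nonNeg i {{nonNegative 0≤i}} 0≤j)

-- Many inequalities below are proved by writing the slack of the goal as a nonnegative combination
-- of known slacks; the ring solver then checks the identity.
<⇒slack : ∀ {i j} → i < j → 0ℤ ≤ j - (1ℤ + i)
<⇒slack i<j = i≤j⇒0≤j-i (i<j⇒suc[i]≤j i<j)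

<-by-slack : ∀ {i j d} → 0ℤ ≤ d → d ≡ j - (1ℤ + i) → i < j
<-by-slack 0≤d d≡ = suc[i]≤j⇒i<j (0≤i-j⇒j≤i (subst (0ℤ ≤_) d≡ 0≤d))

Small : ℤ → Set
Small y = -1ℤ ≤ y × y ≤ 1ℤ

IsUnit⇒Small : ∀ {u} → IsUnit u → Small u
IsUnit⇒Small (inj₁ refl) = -≤+ , ≤-refl
IsUnit⇒Small (inj₂ refl) = ≤-refl , -≤+

Small-neg : ∀ {y} → Small y → Small (- y)
Small-neg (l , u) = neg-mono-≤ u , neg-mono-≤ l

-- The distance from `i` to `x / 2^k` is below 1: `i` is that number if it is an integer, and
-- otherwise its floor or its ceiling.
RoundsTo : ℕ → ℤ → ℤ → Set
RoundsTo k x i = + (2 ℕ.^ k) * i < x + + (2 ℕ.^ k) × x < + (2 ℕ.^ k) * i + + (2 ℕ.^ k)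

module Rounding {V : Set} (_≟ᵛ_ : DecidableEquality V) {m : ℕ} (arc : Fin m → V × V) where
  open Circulations _≟ᵛ_

  IsCirculation : (Fin m → ℤ) → Set
  IsCirculation f = ∀ v → f · (λ e → ∂ (arc e) v) ≡ 0ℤ

  IsCirculation-neg : ∀ {f} → IsCirculation f → IsCirculation (λ e → -1ℤ * f e)
  IsCirculation-neg {f} circ v = trans (·-*ˡ -1ℤ f _) (cong (-1ℤ *_) (circ v))

  -- Since `f` is a circulation, the arcs of odd value have even boundary at every vertex. The signs
  -- that balance them form `y`, which vanishes on the other arcs.
  parity-circulation : ∀ f → IsCirculation f →
    ∃ λ y → IsCirculation y × (∀ e → Small (y e)) × (∀ e → 2ℤ ∣ f e + y e)
  parity-circulation f circ = y , y-circ , small , even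
    where
    -- Loops have no boundary, so only the arcs of odd value count.
    odd-arc : Fin m → V × V
    odd-arc e with 2ℤ ∣? f e
    ... | yes _ = proj₁ (arc e) , proj₁ (arc e)
    ... | no  _ = arc e

    term-even : ∀ v e → 2ℤ ∣ f e * ∂ (arc e) v + ∂ (odd-arc e) v
    term-even v e with 2ℤ ∣? f e
    ... | yes 2∣f = ∣m∣n⇒∣m+n (∣m⇒∣m*n (∂ (arc e) v) 2∣f) (subst (2ℤ ∣_) (sym (∂-loop refl v)) (divides 0ℤ refl))
    ... | no  2∤f = subst (2ℤ ∣_) (regroup (f e) (∂ (arc e) v))
        (∣m⇒∣m*n (∂ (arc e) v) (odd+unit 2∤f (inj₁ refl)))
      where
      regroup : ∀ i d → (i + 1ℤ) * d ≡ i * d + d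
      regroup = solve-∀

    odd-degrees-even : ∀ v → 2ℤ ∣ sum (λ e → ∂ (odd-arc e) v)
    odd-degrees-even v = subst (2ℤ ∣_)
      (trans (∑-distrib-+ (λ e → f e * ∂ (arc e) v) (λ e → ∂ (odd-arc e) v))
             (trans (cong (_+ sum (λ e → ∂ (odd-arc e) v)) (circ v)) (+-identityˡ _)))
      (∣-sum 2ℤ _ (term-even v))

    signs : ∃ λ s → (∀ e → IsUnit (s e)) × (∀ v → sum (λ e → s e * ∂ (odd-arc e) v) ≡ 0ℤ)
    signs = balanced-signs m odd-arc odd-degrees-even
    s : Fin m → ℤ
    s = proj₁ signs

    y : Fin m → ℤ
    y e with 2ℤ ∣? f e
    ... | yes _ = 0ℤ
    ... | no  _ = s e

    y∂≡s∂ : ∀ v e → y e * ∂ (arc e) v ≡ s e * ∂ (odd-arc e) v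
    y∂≡s∂ v e with 2ℤ ∣? f e
    ... | yes _ = sym (trans (cong (s e *_) (∂-loop {proj₁ (arc e)} refl v)) (*-zeroʳ (s e)))
    ... | no  _ = refl

    y-circ : IsCirculation y
    y-circ v = trans (sum-cong-≗ (y∂≡s∂ v)) (proj₂ (proj₂ signs) v)

    small : ∀ e → Small (y e)
    small e with 2ℤ ∣? f e
    ... | yes _ = -≤+ , +≤+ ℕ.z≤n
    ... | no  _ = IsUnit⇒Small (proj₁ (proj₂ signs) e)

    even : ∀ e → 2ℤ ∣ f e + y e
    even e with 2ℤ ∣? f e
    ... | yes 2∣f = subst (2ℤ ∣_) (sym (+-identityʳ (f e))) 2∣f
    ... | no  2∤f = odd+unit 2∤f (proj₁ (proj₂ signs) e)

  -- Both `y` and its negative have the required parity and size, and one of them pairs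
  -- nonnegatively with `w`.
  parity-circulation-improving : ∀ (w f : Fin m → ℤ) → IsCirculation f →
    ∃ λ y → IsCirculation y × (∀ e → Small (y e)) × (∀ e → 2ℤ ∣ f e + y e) × 0ℤ ≤ y · w
  parity-circulation-improving w f circ with parity-circulation f circ
  ... | y , y-circ , small , even with ≤-total 0ℤ (y · w)
  ... | inj₁ 0≤yw = y , y-circ , small , even , 0≤yw
  ... | inj₂ yw≤0 = (λ e → -1ℤ * y e) , IsCirculation-neg {y} y-circ
      , (λ e → subst Small (sym (-1*i≡-i (y e))) (Small-neg (small e)))
      , (λ e → subst (2ℤ ∣_) (regroup (f e) (y e)) (∣m∣n⇒∣m-n (even e) (divides (y e) refl)))
      , subst (0ℤ ≤_) (sym (trans (·-*ˡ -1ℤ y w) (-1*i≡-i (y · w)))) (neg-mono-≤ yw≤0)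
    where
    regroup : ∀ f y → (f + y) - y * 2ℤ ≡ f + -1ℤ * y
    regroup = solve-∀

  -- By integrality `x′` is at distance at most `2^k - 1` from `2^k * i`. Doubling leaves a margin
  -- of 2, of which `y` uses at most 1.
  RoundsTo-double : ∀ k {x x′ y i} → x + y ≡ x′ * 2ℤ → Small y → RoundsTo k x′ i → RoundsTo (ℕ.suc k) x i
  RoundsTo-double k {x} {x′} {y} {i} x+y≡2x′ (-1≤y , y≤1) (lo , hi) =
      subst₂ (λ n a → n * i < a + n) (sym 2N) (sym x≡)
        (<-by-slack (0≤-+ (0≤-* {2ℤ} (+≤+ ℕ.z≤n) (<⇒slack lo)) (i≤j⇒0≤j-i y≤1)) (slack-lo N i x′ y))
    , subst₂ (λ n a → a < n * i + n) (sym 2N) (sym x≡)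
        (<-by-slack (0≤-+ (0≤-* {2ℤ} (+≤+ ℕ.z≤n) (<⇒slack hi)) (i≤j⇒0≤j-i -1≤y)) (slack-hi N i x′ y))
    where
    N : ℤ
    N = + (2 ℕ.^ k)
    2N : + (2 ℕ.^ ℕ.suc k) ≡ 2ℤ * N
    2N = pos-* 2 (2 ℕ.^ k)
    cancel : ∀ x y → x ≡ (x + y) - y
    cancel = solve-∀
    x≡ : x ≡ x′ * 2ℤ - y
    x≡ = trans (cancel x y) (cong (_- y) x+y≡2x′)
    slack-lo : ∀ n i x y → 2ℤ * ((x + n) - (1ℤ + n * i)) + (1ℤ - y)
                         ≡ ((x * 2ℤ - y) + 2ℤ * n) - (1ℤ + (2ℤ * n) * i)
    slack-lo = solve-∀
    slack-hi : ∀ n i x y → 2ℤ * ((n * i + n) - (1ℤ + x)) + (y - -1ℤ)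
                         ≡ ((2ℤ * n) * i + 2ℤ * n) - (1ℤ + (x * 2ℤ - y))
    slack-hi = solve-∀

  -- Each step replaces `f` by `(f + y) / 2` and lowers the exponent of the denominator by one;
  -- `0 ≤ y · w` keeps the weighted total from dropping.
  round-circulation : ∀ k (w f : Fin m → ℤ) → IsCirculation f →
    ∃ λ g → IsCirculation g × (∀ e → RoundsTo k (f e) (g e)) × f · w ≤ + (2 ℕ.^ k) * (g · w)
  round-circulation ℕ.zero w f circ = f , circ , close , ≤-reflexive (sym (*-identityˡ (f · w)))
    where
    i<i+1 : ∀ i → i < i + 1ℤ
    i<i+1 i = <-by-slack ≤-refl (zero-slack i)
      where
      zero-slack : ∀ i → 0ℤ ≡ (i + 1ℤ) - (1ℤ + i)
      zero-slack = solve-∀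
    close : ∀ e → RoundsTo 0 (f e) (f e)
    close e = subst (_< f e + 1ℤ) (sym (*-identityˡ (f e))) (i<i+1 (f e))
            , subst (λ i → f e < i + 1ℤ) (sym (*-identityˡ (f e))) (i<i+1 (f e))
  round-circulation (ℕ.suc k) w f circ with parity-circulation-improving w f circ
  ... | y , y-circ , small , even , 0≤yw =
        let g , g-circ , close , f′w≤gw = round-circulation k w f′ f′-circ in
        g , g-circ , (λ e → RoundsTo-double k (_∣_.equality (even e)) (small e) (close e)) , improve (g · w) f′w≤gw
    where
    f′ : Fin m → ℤ
    f′ e = quotient (even e)
    halved : ∀ x → f · x + y · x ≡ 2ℤ * (f′ · x)
    halved x = begin
      f · x + y · x               ≡⟨ ·-+ f y x ⟨
      (λ e → f e + y e) · x       ≡⟨ sum-cong-≗ (λ e → cong (_* x e) (trans (_∣_.equality (even e)) (*-comm (f′ e) 2ℤ))) ⟩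
      (λ e → 2ℤ * f′ e) · x       ≡⟨ ·-*ˡ 2ℤ f′ x ⟩
      2ℤ * (f′ · x)               ∎
      where open ≡-Reasoning
    f′-circ : IsCirculation f′
    f′-circ v = *-cancelˡ-≡ 2ℤ _ 0ℤ (trans (sym (halved _)) (cong₂ _+_ (circ v) (y-circ v)))
    improve : ∀ x → f′ · w ≤ + (2 ℕ.^ k) * x → f · w ≤ + (2 ℕ.^ ℕ.suc k) * x
    improve x f′w≤ = begin
      f · w                         ≡⟨ +-identityʳ (f · w) ⟨
      f · w + 0ℤ                    ≤⟨ +-monoʳ-≤ (f · w) 0≤yw ⟩
      f · w + y · w                 ≡⟨ halved w ⟩
      2ℤ * (f′ · w)                 ≤⟨ *-monoˡ-≤-nonNeg 2ℤ f′w≤ ⟩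
      2ℤ * (+ (2 ℕ.^ k) * x)        ≡⟨ *-assoc 2ℤ (+ (2 ℕ.^ k)) x ⟨
      2ℤ * + (2 ℕ.^ k) * x          ≡⟨ cong (_* x) (pos-* 2 (2 ℕ.^ k)) ⟨
      + (2 ℕ.^ ℕ.suc k) * x         ∎
      where open ≤-Reasoning

-- Circulations with prescribed throughput at the vertices

sum-join : ∀ m {n} (h : Fin (m ℕ.+ n) → ℤ) → sum h ≡ sum (λ i → h (i ↑ˡ n)) + sum (λ j → h (m ↑ʳ j))
sum-join zero    h = sym (+-identityˡ (sum h))
sum-join (suc m) h = trans (cong (λ s → h zero + s) (sum-join m (h ∘ suc))) (sym (+-assoc (h zero) _ _))

·-++ : ∀ {m n} {A : Set} (g : Fin (m ℕ.+ n) → ℤ) (x : A → ℤ) (a : Fin m → A) (a′ : Fin n → A) →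
  g · (x ∘ (a ++ a′)) ≡ (λ i → g (i ↑ˡ n)) · (x ∘ a) + (λ j → g (m ↑ʳ j)) · (x ∘ a′)
·-++ {m} {n} g x a a′ = trans (sum-join m _) (cong₂ _+_
  (sum-cong-≗ λ i → cong (λ y → g (i ↑ˡ n) * x y) (lookup-++ˡ a a′ i))
  (sum-cong-≗ λ j → cong (λ y → g (m ↑ʳ j) * x y) (lookup-++ʳ a a′ j)))

module _ {m n : ℕ} (tail head : Fin m → Fin n) where
  open Circulations (_≟ᶠ_ {n}) using (δ; δ-refl; δ-≢)
  open Circulations (≡-dec (_≟ᶠ_ {n}) (_≟ᶠ_ {n})) using (∂)

  outFlow inFlow : (Fin m → ℤ) → Fin n → ℤ
  outFlow f v = f · (λ e → δ (tail e) v)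
  inFlow  f v = f · (λ e → δ (head e) v)

  sum-δ : ∀ (f : Fin n → ℤ) v → f · (λ u → δ u v) ≡ f v
  sum-δ f v = trans
    (sum-perturb (λ _ → 0ℤ) (λ u → f u * δ u v) v (f v)
      (trans (cong (f v *_) (δ-refl v)) (trans (*-identityʳ (f v)) (sym (+-identityˡ (f v)))))
      (λ u u≢v → trans (cong (f u *_) (δ-≢ u≢v)) (*-zeroʳ (f u))))
    (trans (cong (_+ f v) (sum-zero {f = λ (_ : Fin n) → 0ℤ} λ _ → refl)) (+-identityˡ (f v)))

  edgeArc : Fin m → (Fin n ⊎ Fin n) × (Fin n ⊎ Fin n)
  edgeArc e = inj₁ (tail e) , inj₂ (head e)
  vertexArc : Fin n → (Fin n ⊎ Fin n) × (Fin n ⊎ Fin n)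
  vertexArc v = inj₂ v , inj₁ v

  -- Each vertex v is split into inj₁ v, where the arcs leave, and inj₂ v, where they enter;
  -- an additional arc from inj₂ v to inj₁ v carries the flow through v.
  splitArc : Fin (m ℕ.+ n) → (Fin n ⊎ Fin n) × (Fin n ⊎ Fin n)
  splitArc = edgeArc ++ vertexArc

  open Rounding (≡-dec (_≟ᶠ_ {n}) (_≟ᶠ_ {n})) splitArc using (IsCirculation; round-circulation)

  module _ (g : Fin (m ℕ.+ n) → ℤ) where
    arcFlow : Fin m → ℤ
    arcFlow e = g (e ↑ˡ n)
    throughFlow : Fin n → ℤ
    throughFlow v = g (m ↑ʳ v)

    private
      negate : ∀ x d → x * (0ℤ - d) ≡ -1ℤ * x * d
      negate = solve-∀

    -- At `inj₁ v` edge arcs only leave and the vertex arc of `v` enters, so conservation there says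
    -- that throughput equals outflow.
    boundary-out : ∀ v → g · (λ e → ∂ (splitArc e) (inj₁ v)) ≡ - outFlow arcFlow v + throughFlow v
    boundary-out v = trans (·-++ g (λ a → ∂ a (inj₁ v)) edgeArc vertexArc) (cong₂ _+_
      (trans (sum-cong-≗ λ e → negate (arcFlow e) (δ (tail e) v))
             (trans (·-*ˡ -1ℤ arcFlow _) (-1*i≡-i (outFlow arcFlow v))))
      (trans (sum-cong-≗ λ u → cong (throughFlow u *_) (+-identityʳ (δ u v))) (sum-δ throughFlow v)))

    boundary-in : ∀ v → g · (λ e → ∂ (splitArc e) (inj₂ v)) ≡ inFlow arcFlow v - throughFlow v
    boundary-in v = trans (·-++ g (λ a → ∂ a (inj₂ v)) edgeArc vertexArc) (cong₂ _+_
      (sum-cong-≗ λ e → cong (arcFlow e *_) (+-identityʳ (δ (head e) v)))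
      (trans (sum-cong-≗ λ u → negate (throughFlow u) (δ u v))
             (trans (·-*ˡ -1ℤ throughFlow _) (trans (-1*i≡-i _) (cong -_ (sum-δ throughFlow v))))))

    circulation⇒outFlow : IsCirculation g → ∀ v → outFlow arcFlow v ≡ throughFlow v
    circulation⇒outFlow circ v = sym (i-j≡0⇒i≡j _ _
      (trans (+-comm (throughFlow v) _) (trans (sym (boundary-out v)) (circ (inj₁ v)))))

    circulation⇒inFlow : IsCirculation g → ∀ v → inFlow arcFlow v ≡ throughFlow v
    circulation⇒inFlow circ v = i-j≡0⇒i≡j _ _ (trans (sym (boundary-in v)) (circ (inj₂ v)))

    flows⇒circulation : (∀ v → outFlow arcFlow v ≡ throughFlow v) → (∀ v → inFlow arcFlow v ≡ throughFlow v) →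
      IsCirculation g
    flows⇒circulation out in′ (inj₁ v) = trans (boundary-out v)
      (trans (+-comm _ (throughFlow v)) (i≡j⇒i-j≡0 (sym (out v))))
    flows⇒circulation out in′ (inj₂ v) = trans (boundary-in v) (i≡j⇒i-j≡0 (in′ v))

  outDegree inDegree : Fin n → ℤ
  outDegree = outFlow (λ _ → 1ℤ)
  inDegree  = inFlow (λ _ → 1ℤ)

  -- Balanced degrees make the constant `c` a flow. Rounding it in the split graph rounds the
  -- throughputs together with the arc values; the weights sit on the vertex arcs alone, so the
  -- functional measures throughput.
  round-constant-flow : (∀ v → outDegree v ≡ inDegree v) → ∀ k c (w : Fin n → ℤ) →
    ∃ λ g → (∀ e → RoundsTo k c (g e))
          × (∀ v → inFlow g v ≡ outFlow g v)
          × (∀ v → RoundsTo k (c * outDegree v) (outFlow g v))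
          × (λ v → c * outDegree v) · w ≤ + (2 ℕ.^ k) * (outFlow g · w)
  round-constant-flow balanced k c w =
    let g , circ , close , improved = round-circulation k ((λ _ → 0ℤ) ++ w) f f-circ
        out≡ = circulation⇒outFlow g circ
    in arcFlow g
     , (λ e → subst (λ x → RoundsTo k x (arcFlow g e)) (f-arc e) (close (e ↑ˡ n)))
     , (λ v → trans (circulation⇒inFlow g circ v) (sym (out≡ v)))
     , (λ v → subst₂ (RoundsTo k) (f-through v) (sym (out≡ v)) (close (m ↑ʳ v)))
     , subst₂ _≤_ (weigh f f-through) (cong (+ (2 ℕ.^ k) *_) (weigh g (sym ∘ out≡))) improved
    where
    t : Fin n → ℤ
    t v = c * outDegree v
    f : Fin (m ℕ.+ n) → ℤ
    f = (λ _ → c) ++ t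
    f-arc : ∀ e → arcFlow f e ≡ c
    f-arc = lookup-++ˡ (λ (_ : Fin m) → c) t
    f-through : ∀ v → throughFlow f v ≡ t v
    f-through = lookup-++ʳ (λ (_ : Fin m) → c) t
    scaled : ∀ (x : Fin m → ℤ) → arcFlow f · x ≡ c * ((λ _ → 1ℤ) · x)
    scaled x = trans (sum-cong-≗ λ e → cong (_* x e) (trans (f-arc e) (sym (*-identityʳ c))))
                     (·-*ˡ c (λ _ → 1ℤ) x)
    f-circ : IsCirculation f
    f-circ = flows⇒circulation f
      (λ v → trans (scaled _) (sym (f-through v)))
      (λ v → trans (scaled _) (trans (cong (c *_) (sym (balanced v))) (sym (f-through v))))
    weigh : ∀ g {h : Fin n → ℤ} → (∀ v → throughFlow g v ≡ h v) → g · ((λ _ → 0ℤ) ++ w) ≡ h · w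
    weigh g {h} through≡h = trans (·-++ g (λ x → x) (λ _ → 0ℤ) w) (trans
      (cong₂ _+_ (sum-zero λ e → *-zeroʳ (arcFlow g e)) (sum-cong-≗ λ v → cong (_* w v) (through≡h v)))
      (+-identityˡ (h · w)))

-- Rounding the constant flow p / q

0≤-sum : ∀ {n} {f : Fin n → ℤ} → (∀ i → 0ℤ ≤ f i) → 0ℤ ≤ sum f
0≤-sum {zero}  0≤f = ≤-refl
0≤-sum {suc n} 0≤f = 0≤-+ (0≤f zero) (0≤-sum (0≤f ∘ suc))

sum-mono-≤ : ∀ {n} {f g : Fin n → ℤ} → (∀ i → f i ≤ g i) → sum f ≤ sum g
sum-mono-≤ {zero}  f≤g = ≤-refl
sum-mono-≤ {suc n} f≤g = +-mono-≤ (f≤g zero) (sum-mono-≤ (f≤g ∘ suc))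

term≤sum : ∀ {n} {f : Fin n → ℤ} → (∀ i → 0ℤ ≤ f i) → ∀ i → f i ≤ sum f
term≤sum {f = f} 0≤f zero    = subst (_≤ sum f) (+-identityʳ (f zero)) (+-monoʳ-≤ (f zero) (0≤-sum (0≤f ∘ suc)))
term≤sum {f = f} 0≤f (suc i) = subst (_≤ sum f) (+-identityˡ (f (suc i))) (+-mono-≤ (0≤f zero) (term≤sum (0≤f ∘ suc) i))

n<2^n : ∀ n → n ℕ.< 2 ℕ.^ n
n<2^n zero    = ℕ.s≤s ℕ.z≤n
n<2^n (suc n) = subst (suc n ℕ.<_) (cong (2 ℕ.^ n ℕ.+_) (sym (ℕ.+-identityʳ (2 ℕ.^ n))))
  (ℕ.+-mono-≤ (ℕ.m^n>0 2 n) (n<2^n n))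

0≰-1 : ¬ (0ℤ ≤ -1ℤ)
0≰-1 ()

∈[0,1] : ∀ {i} → -1ℤ < i → i < + 2 → i ≡ 0ℤ ⊎ i ≡ 1ℤ
∈[0,1] {+ 0} _ _ = inj₁ refl
∈[0,1] {+ 1} _ _ = inj₂ refl
∈[0,1] {+ (ℕ.suc (ℕ.suc _))} _ (+<+ (ℕ.s<s (ℕ.s<s ())))
∈[0,1] { -[1+ _ ]} (-<- ()) _

module _ {m n : ℕ} (tail head : Fin m → Fin n)
  (balanced : ∀ v → outDegree tail head v ≡ inDegree tail head v)
  (p : ℤ) (q : ℕ) {{_ : ℕ.NonZero q}} (0≤p : 0ℤ ≤ p) (p≤q : p ≤ + q) where

  private
    Q : ℤ
    Q = + q
    0≤Q : 0ℤ ≤ Q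
    0≤Q = +≤+ ℕ.z≤n
    1≤Q : 1ℤ ≤ Q
    1≤Q = +≤+ (ℕ.>-nonZero⁻¹ q)

    d : Fin n → ℤ
    d = outDegree tail head
    open Circulations (_≟ᶠ_ {n}) using (δ)
    0≤d : ∀ v → 0ℤ ≤ d v
    0≤d v = 0≤-sum λ e → subst (0ℤ ≤_) (sym (*-identityˡ _)) (0≤δ (tail e))
      where
      0≤δ : ∀ u → 0ℤ ≤ δ u v
      0≤δ u with u ≟ᶠ v
      ... | yes _ = +≤+ ℕ.z≤n
      ... | no  _ = ≤-refl

    D : ℤ
    D = sum d
    0≤D : 0ℤ ≤ D
    0≤D = 0≤-sum 0≤d

    -- Chosen so that `N` exceeds `Q * D`: an error below `1 / N` in the ratio `p / q`, summed over
    -- all throughputs and multiplied by `Q`, then stays below 1.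
    k : ℕ
    k = ∣ Q * D ∣
    N : ℤ
    N = + (2 ℕ.^ k)
    0≤N : 0ℤ ≤ N
    0≤N = +≤+ ℕ.z≤n
    QD<N : Q * D < N
    QD<N = subst (_< N) (0≤i⇒+∣i∣≡i (0≤-* 0≤Q 0≤D)) (+<+ (n<2^n k))

    -- The fraction `c / N` approximates `p / q` from below with error less than `1 / N`.
    c : ℤ
    c = (N * p) /ℕ q
    cQ≤Np : c * Q ≤ N * p
    cQ≤Np = [n/ℕd]*d≤n (N * p) q
    Np<cQ+Q : N * p < (1ℤ + c) * Q
    Np<cQ+Q = n<s[n/ℕd]*d (N * p) q
    0≤c : 0ℤ ≤ c
    0≤c = 0≤n⇒0≤n/ℕd (N * p) q (0≤-* 0≤N 0≤p)
    c≤N : c ≤ N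
    c≤N = *-cancelʳ-≤-pos c N Q {{positive (<-≤-trans (+<+ (ℕ.s≤s ℕ.z≤n)) 1≤Q)}}
      (≤-trans cQ≤Np (*-monoˡ-≤-nonNeg N p≤q))

    -- Maximised are the throughputs whose targets p d(v) / q are integers.
    w : Fin n → ℤ
    w v with Q ∣? p * d v
    ... | yes _ = 1ℤ
    ... | no  _ = 0ℤ

    rounded : ∃ λ g → (∀ e → RoundsTo k c (g e))
                    × (∀ v → inFlow tail head g v ≡ outFlow tail head g v)
                    × (∀ v → RoundsTo k (c * d v) (outFlow tail head g v))
                    × (λ v → c * d v) · w ≤ N * (outFlow tail head g · w)
    rounded = round-constant-flow tail head balanced k c w

    g : Fin m → ℤ
    g = proj₁ rounded
    t : Fin n → ℤ
    t = outFlow tail head g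
    rounds-t : ∀ v → RoundsTo k (c * d v) (t v)
    rounds-t = proj₁ (proj₂ (proj₂ (proj₂ rounded)))

    -- As `c / N` lies between 0 and 1, an integer at distance below 1 from it lies strictly between
    -- -1 and 2.
    g-binary : ∀ e → g e ≡ 0ℤ ⊎ g e ≡ 1ℤ
    g-binary e = ∈[0,1]
      (*-cancelˡ-<-nonNeg N (<-by-slack (0≤-+ (<⇒slack (proj₂ close)) 0≤c) (below N c (g e))))
      (*-cancelˡ-<-nonNeg N (<-by-slack (0≤-+ (<⇒slack (proj₁ close)) (i≤j⇒0≤j-i c≤N)) (above N c (g e))))
      where
      close : RoundsTo k c (g e)
      close = proj₁ (proj₂ rounded) e
      below : ∀ n c x → ((n * x + n) - (1ℤ + c)) + c ≡ n * x - (1ℤ + n * -1ℤ)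
      below = solve-∀
      above : ∀ n c x → ((c + n) - (1ℤ + n * x)) + (n - c) ≡ n * (+ 2) - (1ℤ + n * x)
      above = solve-∀

    -- Rounding gives `t < c d / N + 1`, and replacing `c / N` by the larger `p / q` only weakens
    -- this.
    upper : ∀ v → Q * t v < p * d v + Q
    upper v = *-cancelˡ-<-nonNeg N (<-by-slack
      (0≤-+ (0≤-+ (0≤-* 0≤Q (<⇒slack (proj₁ (rounds-t v)))) (0≤-* (i≤j⇒0≤j-i cQ≤Np) (0≤d v))) (i≤j⇒0≤j-i 1≤Q))
      (slack N Q p c (d v) (t v)))
      where
      slack : ∀ n q p c d t → (q * ((c * d + n) - (1ℤ + n * t)) + (n * p - c * q) * d) + (q - 1ℤ)
                            ≡ n * (p * d + q) - (1ℤ + n * (q * t))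
      slack = solve-∀

    -- If p d ≥ Q t + Q, then p d ≥ Q t + Q + 1 by indivisibility; collapse is a nonnegative
    -- combination of this and the known inequalities whose value is -1.
    lower-inexact : ∀ v → ¬ (Q ∣ p * d v) → p * d v < Q * t v + Q
    lower-inexact v Q∤pd = ≰⇒> λ Qt+Q≤pd → 0≰-1 (subst (0ℤ ≤_) (collapse N Q p c (d v) (t v) D)
      (0≤-+ (0≤-+ (0≤-+ (0≤-+ (0≤-+ (0≤-+
        (0≤-* 0≤N (<⇒slack (≤∧≢⇒< Qt+Q≤pd λ eq → Q∤pd (subst (Q ∣_) eq
          (divides (t v + 1ℤ) (factor Q (t v)))))))
        (0≤-* (0≤d v) (<⇒slack Np<cQ+Q)))
        (0≤-* 0≤Q (<⇒slack (proj₂ (rounds-t v)))))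
        (<⇒slack QD<N))
        (0≤-* 0≤Q (i≤j⇒0≤j-i (term≤sum 0≤d v))))
        (0≤d v))
        0≤Q))
      where
      factor : ∀ q t → q * t + q ≡ (t + 1ℤ) * q
      factor = solve-∀
      collapse : ∀ n q p c d t D →
        (((((n * (p * d - (1ℤ + (q * t + q))) + d * ((1ℤ + c) * q - (1ℤ + n * p)))
          + q * ((n * t + n) - (1ℤ + c * d))) + (n - (1ℤ + q * D))) + q * (D - d)) + d) + q ≡ -1ℤ
      collapse = solve-∀

    -- Target minus attained throughput, multiplied by `Q` to be an integer and counted only where
    -- the target is an integer.
    excess : Fin n → ℤ
    excess v = (p * d v - Q * t v) * w v

    -- The weighted total did not drop, so `c M ≤ N X`. Hence `N (p M - Q X) ≤ (N p - c Q) M ≤ Q M ≤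
    -- Q D < N`.
    total-excess<1 : sum excess < 1ℤ
    total-excess<1 = *-cancelˡ-<-nonNeg N (subst (λ x → N * x < N * 1ℤ) (sym total) (<-by-slack
      (0≤-+ (0≤-+ (0≤-+ (0≤-+
        (<⇒slack QD<N)
        (0≤-* 0≤Q (i≤j⇒0≤j-i M≤D)))
        (0≤-* 0≤M (<⇒slack Np<cQ+Q)))
        0≤M)
        (0≤-* 0≤Q (i≤j⇒0≤j-i cM≤NX)))
      (slack N Q p c M X D)))
      where
      M X : ℤ
      M = d · w
      X = t · w
      0≤dw : ∀ v → 0ℤ ≤ d v * w v
      0≤dw v with Q ∣? p * d v
      ... | yes _ = subst (0ℤ ≤_) (sym (*-identityʳ (d v))) (0≤d v)
      ... | no  _ = ≤-reflexive (sym (*-zeroʳ (d v)))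
      dw≤d : ∀ v → d v * w v ≤ d v
      dw≤d v with Q ∣? p * d v
      ... | yes _ = ≤-reflexive (*-identityʳ (d v))
      ... | no  _ = subst (_≤ d v) (sym (*-zeroʳ (d v))) (0≤d v)
      0≤M : 0ℤ ≤ M
      0≤M = 0≤-sum 0≤dw
      M≤D : M ≤ D
      M≤D = sum-mono-≤ dw≤d
      cM≤NX : c * M ≤ N * X
      cM≤NX = subst (_≤ N * X) (·-*ˡ c d w) (proj₂ (proj₂ (proj₂ (proj₂ rounded))))
      total : sum excess ≡ p * M + - Q * X
      total = begin
        sum excess
          ≡⟨ sum-cong-≗ (λ v → cong (_* w v) (cong (λ x → p * d v + x) (neg-distribˡ-* Q (t v)))) ⟩
        (λ v → p * d v + - Q * t v) · w
          ≡⟨ ·-+ (λ v → p * d v) (λ v → - Q * t v) w ⟩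
        (λ v → p * d v) · w + (λ v → - Q * t v) · w
          ≡⟨ cong₂ _+_ (·-*ˡ p d w) (·-*ˡ (- Q) t w) ⟩
        p * M + - Q * X ∎
        where open ≡-Reasoning
      slack : ∀ n q p c m x D →
        ((((n - (1ℤ + q * D)) + q * (D - m)) + m * ((1ℤ + c) * q - (1ℤ + n * p))) + m) + q * (n * x - c * m)
        ≡ n * 1ℤ - (1ℤ + n * (p * m + - q * x))
      slack = solve-∀

    w-exact : ∀ v → Q ∣ p * d v → w v ≡ 1ℤ
    w-exact v Q∣pd with Q ∣? p * d v
    ... | yes _   = refl
    ... | no Q∤pd = ⊥-elim (Q∤pd Q∣pd)

    w-inexact : ∀ v → ¬ (Q ∣ p * d v) → w v ≡ 0ℤ
    w-inexact v Q∤pd with Q ∣? p * d v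
    ... | yes Q∣pd = ⊥-elim (Q∤pd Q∣pd)
    ... | no _     = refl

    -- Where the target is an integer `j`, `upper` gives `t < 1 + j`, so integrality gives `t ≤ j`.
    0≤excess : ∀ v → 0ℤ ≤ excess v
    0≤excess v = by-divisibility (Q ∣? p * d v)
      where
      factor : ∀ q j → j * q + q ≡ q * (1ℤ + j)
      factor = solve-∀
      cancel : ∀ j t → (1ℤ + j) - (1ℤ + t) ≡ j - t
      cancel = solve-∀
      by-divisibility : Dec (Q ∣ p * d v) → 0ℤ ≤ excess v
      by-divisibility (no Q∤pd) = ≤-reflexive (sym
        (trans (cong ((p * d v - Q * t v) *_) (w-inexact v Q∤pd)) (*-zeroʳ (p * d v - Q * t v))))
      by-divisibility (yes Q∣pd@(divides j pd≡jQ)) = subst (0ℤ ≤_)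
        (sym (trans (cong ((p * d v - Q * t v) *_) (w-exact v Q∣pd)) (*-identityʳ (p * d v - Q * t v))))
        (i≤j⇒0≤j-i (subst₂ _≤_ (*-comm (t v) Q) (sym pd≡jQ) (*-monoʳ-≤-nonNeg Q t≤j)))
        where
        t<1+j : t v < 1ℤ + j
        t<1+j = *-cancelˡ-<-nonNeg Q (subst (Q * t v <_) (trans (cong (_+ Q) pd≡jQ) (factor Q j)) (upper v))
        t≤j : t v ≤ j
        t≤j = 0≤i-j⇒j≤i (subst (0ℤ ≤_) (cancel j (t v)) (<⇒slack t<1+j))

    -- All excesses are nonnegative with total below 1, so each single one is below 1.
    lower-exact : ∀ v → Q ∣ p * d v → p * d v < Q * t v + Q
    lower-exact v Q∣pd = <-by-slack (0≤-+ (<⇒slack pd-Qt<1) (i≤j⇒0≤j-i 1≤Q)) (slack (p * d v) (Q * t v) Q)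
      where
      excess≡ : excess v ≡ p * d v - Q * t v
      excess≡ = trans (cong ((p * d v - Q * t v) *_) (w-exact v Q∣pd)) (*-identityʳ _)
      pd-Qt<1 : p * d v - Q * t v < 1ℤ
      pd-Qt<1 = subst (_< 1ℤ) excess≡ (≤-<-trans (term≤sum 0≤excess v) total-excess<1)
      slack : ∀ x y q → (1ℤ - (1ℤ + (x - y))) + (q - 1ℤ) ≡ (y + q) - (1ℤ + x)
      slack = solve-∀

    lower : ∀ v → p * d v < Q * t v + Q
    lower v = by-divisibility (Q ∣? p * d v)
      where
      by-divisibility : Dec (Q ∣ p * d v) → p * d v < Q * t v + Q
      by-divisibility (yes Q∣pd) = lower-exact v Q∣pd
      by-divisibility (no  Q∤pd) = lower-inexact v Q∤pd

  -- With denominators cleared, the two inequalities say that the outflow at `v` differs from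
  -- `p / q` times the outdegree by less than 1.
  rational-flow : ∃ λ (g : Fin m → ℤ) → (∀ e → g e ≡ 0ℤ ⊎ g e ≡ 1ℤ)
    × (∀ v → inFlow tail head g v ≡ outFlow tail head g v)
    × (∀ v → Q * outFlow tail head g v < p * outDegree tail head v + Q)
    × (∀ v → p * outDegree tail head v < Q * outFlow tail head g v + Q)
  rational-flow = g , g-binary , proj₁ (proj₂ (proj₂ rounded)) , upper , lower

-- From flows to even factors

+sumFin : ∀ m (f : Fin m → ℕ) → + sumFin m f ≡ sum (λ e → + f e)
+sumFin zero    f = refl
+sumFin (suc m) f = cong (λ x → + f zero + x) (+sumFin m (f ∘ suc))

module _ {n : ℕ} where
  open Circulations (_≟ᶠ_ {n})

  +incidence : ∀ a b v → + incidence (a , b) v ≡ δ a v + δ b v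
  +incidence a b v with a ≟ᶠ v | b ≟ᶠ v
  ... | yes _ | yes _ = refl
  ... | yes _ | no  _ = refl
  ... | no  _ | yes _ = refl
  ... | no  _ | no  _ = refl

-- Gives access to the terms of degIn, which are formed by a local function.
summand : ∀ {x m} {f : Fin m → ℕ} → x ≡ sumFin m f → Fin m → ℕ
summand {f = f} _ = f

+keep : ∀ (G : Graph) (F : SpanningSubgraph G) (g : Fin (nE G) → ℤ) →
  (∀ e → (F e ≡ true × g e ≡ 1ℤ) ⊎ (F e ≡ false × g e ≡ 0ℤ)) →
  ∀ v → + degIn G F v ≡ g · (λ e → + incidence (ends G e) v)
+keep G F g indicator v = trans (+sumFin (nE G) _) (sum-cong-≗ term)
  where
  term : ∀ e → + summand {degIn G F v} refl e ≡ g e * + incidence (ends G e) v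
  term e with F e | g e | indicator e
  ... | _ | _ | inj₁ (refl , refl) = sym (*-identityˡ _)
  ... | _ | _ | inj₂ (refl , refl) = refl

module _ (G : Graph) (even : ∀ v → Even (deg G v)) where
  private
    n m : ℕ
    n = nV G
    m = nE G
    open Circulations (_≟ᶠ_ {n})

    deg≡ : ∀ v → + deg G v ≡ (λ _ → 1ℤ) · (λ e → + incidence (ends G e) v)
    deg≡ v = trans (+sumFin m (λ e → incidence (ends G e) v)) (sum-cong-≗ λ e → sym (*-identityˡ (+ incidence (ends G e) v)))

    -- Boundary and degree agree modulo 2, because `a + b` and `b - a` differ by `2 a`.
    even-boundary : ∀ v → 2ℤ ∣ sum (λ e → ∂ (ends G e) v)
    even-boundary v = ∣m+n∣n⇒∣m {2ℤ} {sum (λ e → ∂ (ends G e) v)} (subst (2ℤ ∣_) eq (∣ᵤ⇒∣ (even v)))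
      (divides (sum (λ e → δ (proj₁ (ends G e)) v)) refl)
      where
      regroup : ∀ a b → a + b ≡ (b - a) + a * 2ℤ
      regroup = solve-∀
      eq : + deg G v ≡ sum (λ e → ∂ (ends G e) v) + sum (λ e → δ (proj₁ (ends G e)) v) * 2ℤ
      eq = begin
        + deg G v
          ≡⟨ +sumFin m _ ⟩
        sum (λ e → + incidence (ends G e) v)
          ≡⟨ sum-cong-≗ (λ e → trans (+incidence (proj₁ (ends G e)) (proj₂ (ends G e)) v)
                                     (regroup (δ (proj₁ (ends G e)) v) (δ (proj₂ (ends G e)) v))) ⟩
        sum (λ e → ∂ (ends G e) v + δ (proj₁ (ends G e)) v * 2ℤ)
          ≡⟨ ∑-distrib-+ (λ e → ∂ (ends G e) v) _ ⟩
        sum (λ e → ∂ (ends G e) v) + sum (λ e → δ (proj₁ (ends G e)) v * 2ℤ)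
          ≡⟨ cong (λ x → sum (λ e → ∂ (ends G e) v) + x) (*-distribʳ-sum 2ℤ (λ e → δ (proj₁ (ends G e)) v)) ⟨
        sum (λ e → ∂ (ends G e) v) + sum (λ e → δ (proj₁ (ends G e)) v) * 2ℤ ∎
        where open ≡-Reasoning

    signs : ∃ λ s → (∀ e → IsUnit (s e)) × (∀ v → sum (λ e → s e * ∂ (ends G e) v) ≡ 0ℤ)
    signs = balanced-signs m (ends G) even-boundary
    s : Fin m → ℤ
    s = proj₁ signs

    orient : ∀ {u} → IsUnit u → Fin n × Fin n → Fin n × Fin n
    orient (inj₁ _) (a , b) = a , b
    orient (inj₂ _) (a , b) = b , a

    oriented : Fin m → Fin n × Fin n
    oriented e = orient (proj₁ (proj₂ signs) e) (ends G e)
    tail head : Fin m → Fin n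
    tail = proj₁ ∘ oriented
    head = proj₂ ∘ oriented

    ∂-orient : ∀ {u} (unit : IsUnit u) arc v → ∂ (orient unit arc) v ≡ u * ∂ arc v
    ∂-orient (inj₁ refl) (a , b) v = sym (*-identityˡ _)
    ∂-orient (inj₂ refl) (a , b) v = swap (δ a v) (δ b v)
      where
      swap : ∀ a b → a - b ≡ -1ℤ * (b - a)
      swap = solve-∀

    incidence-orient : ∀ {u} (unit : IsUnit u) arc v →
      + incidence arc v ≡ δ (proj₁ (orient unit arc)) v + δ (proj₂ (orient unit arc)) v
    incidence-orient (inj₁ _) (a , b) v = +incidence a b v
    incidence-orient (inj₂ _) (a , b) v = trans (+incidence a b v) (+-comm (δ a v) (δ b v))

    flow-through-incidence : ∀ g v → g · (λ e → + incidence (ends G e) v) ≡ outFlow tail head g v + inFlow tail head g v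
    flow-through-incidence g v = trans
      (sum-cong-≗ λ e → trans (cong (g e *_) (incidence-orient (proj₁ (proj₂ signs) e) (ends G e) v))
                              (*-distribˡ-+ (g e) _ _))
      (∑-distrib-+ (λ e → g e * δ (tail e) v) (λ e → g e * δ (head e) v))

    balanced : ∀ v → outDegree tail head v ≡ inDegree tail head v
    balanced v = sym (i-j≡0⇒i≡j _ _ (begin
      inDegree tail head v - outDegree tail head v
        ≡⟨ cong (λ x → inDegree tail head v + x)
             (sym (trans (·-*ˡ -1ℤ (λ _ → 1ℤ) (λ e → δ (tail e) v)) (-1*i≡-i (outDegree tail head v)))) ⟩
      inDegree tail head v + (λ _ → -1ℤ) · (λ e → δ (tail e) v)
        ≡⟨ ∑-distrib-+ (λ e → 1ℤ * δ (head e) v) (λ e → -1ℤ * δ (tail e) v) ⟨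
      sum (λ e → 1ℤ * δ (head e) v + -1ℤ * δ (tail e) v)
        ≡⟨ sum-cong-≗ (λ e → trans (simplify (δ (head e) v) (δ (tail e) v)) (∂-orient (proj₁ (proj₂ signs) e) (ends G e) v)) ⟩
      sum (λ e → s e * ∂ (ends G e) v)
        ≡⟨ proj₂ (proj₂ signs) v ⟩
      0ℤ ∎))
      where
      open ≡-Reasoning
      simplify : ∀ h t → 1ℤ * h + -1ℤ * t ≡ h - t
      simplify = solve-∀

    double : ∀ x → x + x ≡ x * 2ℤ
    double = solve-∀

    deg≡2out : ∀ v → + deg G v ≡ outDegree tail head v * 2ℤ
    deg≡2out v = trans (deg≡ v) (trans (flow-through-incidence (λ _ → 1ℤ) v)
      (trans (cong (λ x → outDegree tail head v + x) (sym (balanced v))) (double (outDegree tail head v))))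

  module _ (p : ℤ) (q : ℕ) (g : Fin m → ℤ) (binary : ∀ e → g e ≡ 0ℤ ⊎ g e ≡ 1ℤ)
    (conserved : ∀ v → inFlow tail head g v ≡ outFlow tail head g v)
    (upper : ∀ v → + q * outFlow tail head g v < p * outDegree tail head v + + q)
    (lower : ∀ v → p * outDegree tail head v < + q * outFlow tail head g v + + q) where
    keep : ∀ {i} → i ≡ 0ℤ ⊎ i ≡ 1ℤ → Bool
    keep (inj₁ _) = false
    keep (inj₂ _) = true
    F : SpanningSubgraph G
    F e = keep (binary e)
    indicator : ∀ e → (F e ≡ true × g e ≡ 1ℤ) ⊎ (F e ≡ false × g e ≡ 0ℤ)
    indicator e = indicate (binary e)
      where
      indicate : ∀ {i} (b : i ≡ 0ℤ ⊎ i ≡ 1ℤ) → (keep b ≡ true × i ≡ 1ℤ) ⊎ (keep b ≡ false × i ≡ 0ℤ)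
      indicate (inj₁ i≡0) = inj₂ (refl , i≡0)
      indicate (inj₂ i≡1) = inj₁ (refl , i≡1)
    degIn≡2out : ∀ v → + degIn G F v ≡ outFlow tail head g v * 2ℤ
    degIn≡2out v = trans (+keep G F g indicator v) (trans (flow-through-incidence g v)
      (trans (cong (λ x → outFlow tail head g v + x) (conserved v)) (double (outFlow tail head g v))))
    distrib : ∀ a b c → (a * b + c) * 2ℤ ≡ a * (b * 2ℤ) + c * 2ℤ
    distrib = solve-∀
    left : ∀ v → + q * outFlow tail head g v * 2ℤ ≡ + q * + degIn G F v
    left v = trans (*-assoc (+ q) (outFlow tail head g v) 2ℤ) (cong (+ q *_) (sym (degIn≡2out v)))
    right : ∀ v → (p * outDegree tail head v + + q) * 2ℤ ≡ p * + deg G v + + q * 2ℤ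
    right v = trans (distrib p (outDegree tail head v) (+ q)) (cong (λ x → p * x + + q * 2ℤ) (sym (deg≡2out v)))
    left′ : ∀ v → p * outDegree tail head v * 2ℤ ≡ p * + deg G v
    left′ v = trans (*-assoc p (outDegree tail head v) 2ℤ) (cong (p *_) (sym (deg≡2out v)))
    right′ : ∀ v → (+ q * outFlow tail head g v + + q) * 2ℤ ≡ + q * + degIn G F v + + q * 2ℤ
    right′ v = trans (distrib (+ q) (outFlow tail head g v) (+ q)) (cong (λ x → + q * x + + q * 2ℤ) (sym (degIn≡2out v)))

    -- Conservation makes each degree in `F` twice the outflow, hence even; the error bound 1 for
    -- throughputs doubles to 2 for degrees.
    flow⇒even-factor : ∃ λ (F : SpanningSubgraph G) → IsEvenFactor G F
      × (∀ v → + q * + degIn G F v < p * + deg G v + + q * 2ℤ)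
      × (∀ v → p * + deg G v < + q * + degIn G F v + + q * 2ℤ)
    flow⇒even-factor = F
      , (λ v → ∣⇒∣ᵤ (divides {2ℤ} {+ degIn G F v} (outFlow tail head g v) (degIn≡2out v)))
      , (λ v → subst₂ _<_ (left v) (right v) (*-monoʳ-<-pos 2ℤ (upper v)))
      , (λ v → subst₂ _<_ (left′ v) (right′ v) (*-monoʳ-<-pos 2ℤ (lower v)))

  rational-even-factor : ∀ (p : ℤ) (q : ℕ) {{_ : ℕ.NonZero q}} → 0ℤ ≤ p → p ≤ + q →
    ∃ λ (F : SpanningSubgraph G) → IsEvenFactor G F
      × (∀ v → + q * + degIn G F v < p * + deg G v + + q * 2ℤ)
      × (∀ v → p * + deg G v < + q * + degIn G F v + + q * 2ℤ)
  rational-even-factor p q 0≤p p≤q =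
    let g , binary , conserved , upper , lower = rational-flow tail head balanced p q 0≤p p≤q
    in flow⇒even-factor p q g binary conserved upper lower

-- Rational substitutes of a real

module _ (ε : ℝ) where

  L-down : ∀ {q r} → q ℚ.≤ r → L ε r → L ε q
  L-down {q} {r} q≤r Lr =
    let r′ , r<r′ , Lr′ = Equivalence.to (L-rounded ε r) Lr
    in Equivalence.from (L-rounded ε q) (r′ , ℚ.≤-<-trans q≤r r<r′ , Lr′)

  U-up : ∀ {q r} → q ℚ.≤ r → U ε q → U ε r
  U-up {q} {r} q≤r Uq =
    let q′ , q′<q , Uq′ = Equivalence.to (U-rounded ε q) Uq
    in Equivalence.from (U-rounded ε r) (q′ , ℚ.<-≤-trans q′<q q≤r , Uq′)

  L≤U : ∀ {l u} → L ε l → U ε u → l ℚ.≤ u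
  L≤U {l} {u} Ll Uu with ℚ.≤-total l u
  ... | inj₁ l≤u = l≤u
  ... | inj₂ u≤l = ⊥-elim (disjoint ε l (Ll , U-up u≤l Uu))

  -- A rational bracket l ≤ x ≤ u of ε in whose interior only x itself can be a threshold.
  record Bracket (T : List ℚ) : Set where
    field
      l u x : ℚ
      l≤x : l ℚ.≤ x
      x≤u : x ℚ.≤ u
      Ll : L ε l
      Uu : U ε u
      isolated : All (λ t → t ℚ.≤ l ⊎ u ℚ.≤ t ⊎ t ≡ x) T

  -- A new threshold `t` inside the bracket and distinct from `x` is compared with `x`, and
  -- `located` is applied to the two. Its answer moves one end of the bracket to `t` or `x`; the
  -- other of the two remains as the only interior threshold.
  bracket : ∀ T → Bracket T
  bracket [] = let l , Ll = L-inhabited ε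
                   u , Uu = U-inhabited ε
               -- Without thresholds any point of the bracket can serve as `x`.
               in record { l = l ; u = u ; x = l ; l≤x = ℚ.≤-refl ; x≤u = L≤U Ll Uu ; Ll = Ll ; Uu = Uu ; isolated = [] }
  bracket (t ∷ T) = refine (t ℚ.≤? l) (u ℚ.≤? t) (ℚ.<-cmp t x)
    where
    open Bracket (bracket T)
    refine : Dec (t ℚ.≤ l) → Dec (u ℚ.≤ t) → Tri (t ℚ.< x) (t ≡ x) (x ℚ.< t) → Bracket (t ∷ T)
    refine (yes t≤l) _ _ = record { Bracket (bracket T) ; isolated = inj₁ t≤l ∷ isolated }
    refine _ (yes u≤t) _ = record { Bracket (bracket T) ; isolated = inj₂ (inj₁ u≤t) ∷ isolated }
    refine _ _ (tri≈ _ t≡x _) = record { Bracket (bracket T) ; isolated = inj₂ (inj₂ t≡x) ∷ isolated }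
    refine (no t≰l) _ (tri< t<x _ _) with located ε t x t<x
    ... | inj₁ Lt = record { l = t ; u = u ; x = x ; l≤x = ℚ.<⇒≤ t<x ; x≤u = x≤u ; Ll = Lt ; Uu = Uu
      ; isolated = inj₁ ℚ.≤-refl ∷ All.map (λ
          { (inj₁ t′≤l)  → inj₁ (ℚ.≤-trans t′≤l (ℚ.<⇒≤ (ℚ.≰⇒> t≰l)))
          ; (inj₂ t′≥u⊎x) → inj₂ t′≥u⊎x }) isolated }
    ... | inj₂ Ux = record { l = l ; u = x ; x = t ; l≤x = ℚ.<⇒≤ (ℚ.≰⇒> t≰l) ; x≤u = ℚ.<⇒≤ t<x ; Ll = Ll ; Uu = Ux
      ; isolated = inj₂ (inj₂ refl) ∷ All.map (λ
          { (inj₁ t′≤l)        → inj₁ t′≤l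
          ; (inj₂ (inj₁ u≤t′)) → inj₂ (inj₁ (ℚ.≤-trans x≤u u≤t′))
          ; (inj₂ (inj₂ refl)) → inj₂ (inj₁ ℚ.≤-refl) }) isolated }
    refine _ (no u≰t) (tri> _ _ x<t) with located ε x t x<t
    ... | inj₁ Lx = record { l = x ; u = u ; x = t ; l≤x = ℚ.<⇒≤ x<t ; x≤u = ℚ.<⇒≤ (ℚ.≰⇒> u≰t) ; Ll = Lx ; Uu = Uu
      ; isolated = inj₂ (inj₂ refl) ∷ All.map (λ
          { (inj₁ t′≤l)        → inj₁ (ℚ.≤-trans t′≤l l≤x)
          ; (inj₂ (inj₁ u≤t′)) → inj₂ (inj₁ u≤t′)
          ; (inj₂ (inj₂ refl)) → inj₁ ℚ.≤-refl }) isolated }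
    ... | inj₂ Ut = record { l = l ; u = t ; x = x ; l≤x = l≤x ; x≤u = ℚ.<⇒≤ x<t ; Ll = Ll ; Uu = Ut
      ; isolated = inj₂ (inj₁ ℚ.≤-refl) ∷ All.map (λ
          { (inj₁ t′≤l)        → inj₁ t′≤l
          ; (inj₂ (inj₁ u≤t′)) → inj₂ (inj₁ (ℚ.≤-trans (ℚ.<⇒≤ (ℚ.≰⇒> u≰t)) u≤t′))
          ; (inj₂ (inj₂ t′≡x)) → inj₂ (inj₂ t′≡x) }) isolated }

  -- Thresholds outside the interior of the bracket are on a known side of `ε`. A threshold equal to
  -- `x` satisfies neither strict premise, so the undecidable comparison of `ε` with `x` is avoided.
  rational-substitute : ∀ T → ∃ λ x → ∀ {t} → t ∈ T → (t ℚ.< x → L ε t) × (x ℚ.< t → U ε t)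
  rational-substitute T = x , λ t∈T → separate (All.lookup isolated t∈T)
    where
    open Bracket (bracket T)
    separate : ∀ {t} → t ℚ.≤ l ⊎ u ℚ.≤ t ⊎ t ≡ x → (t ℚ.< x → L ε t) × (x ℚ.< t → U ε t)
    separate (inj₁ t≤l) = (λ _ → L-down t≤l Ll) , λ x<t → ⊥-elim (ℚ.<-irrefl refl (ℚ.<-≤-trans x<t (ℚ.≤-trans t≤l l≤x)))
    separate (inj₂ (inj₁ u≤t)) = (λ t<x → ⊥-elim (ℚ.<-irrefl refl (ℚ.<-≤-trans t<x (ℚ.≤-trans x≤u u≤t)))) , λ _ → U-up u≤t Uu
    separate (inj₂ (inj₂ refl)) = (λ t<t → ⊥-elim (ℚ.<-irrefl refl t<t)) , λ t<t → ⊥-elim (ℚ.<-irrefl refl t<t)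

-- Rational arithmetic and the transfer of bounds through thresholds

toℚᵘ-/ : ∀ i d → toℚᵘ (i ℚ./ ℕ.suc d) ℚᵘ.≃ mkℚᵘ i d
toℚᵘ-/ i d = ℚ.toℚᵘ-fromℚᵘ (mkℚᵘ i d)

/-+ : ∀ i j → i ℚ./ 1 ℚ.+ j ℚ./ 1 ≡ (i + j) ℚ./ 1
/-+ i j = ℚ.toℚᵘ-injective (begin
  toℚᵘ (i ℚ./ 1 ℚ.+ j ℚ./ 1)             ≈⟨ ℚ.toℚᵘ-homo-+ (i ℚ./ 1) (j ℚ./ 1) ⟩
  toℚᵘ (i ℚ./ 1) ℚᵘ.+ toℚᵘ (j ℚ./ 1)     ≈⟨ ℚᵘ.+-cong (toℚᵘ-/ i 0) (toℚᵘ-/ j 0) ⟩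
  mkℚᵘ i 0 ℚᵘ.+ mkℚᵘ j 0                 ≈⟨ *≡* (cong (_* 1ℤ) (cong₂ _+_ (*-identityʳ i) (*-identityʳ j))) ⟩
  mkℚᵘ (i + j) 0                         ≈⟨ toℚᵘ-/ (i + j) 0 ⟨
  toℚᵘ ((i + j) ℚ./ 1)                   ∎)
  where open import Relation.Binary.Reasoning.Setoid ℚᵘ.≃-setoid

/-*-cancel : ∀ i d → (i ℚ./ ℕ.suc d) ℚ.* ℕ→ℚ (ℕ.suc d) ≡ i ℚ./ 1
/-*-cancel i d = ℚ.toℚᵘ-injective (begin
  toℚᵘ ((i ℚ./ ℕ.suc d) ℚ.* ℕ→ℚ (ℕ.suc d))            ≈⟨ ℚ.toℚᵘ-homo-* (i ℚ./ ℕ.suc d) (ℕ→ℚ (ℕ.suc d)) ⟩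
  toℚᵘ (i ℚ./ ℕ.suc d) ℚᵘ.* toℚᵘ (ℕ→ℚ (ℕ.suc d))      ≈⟨ ℚᵘ.*-cong (toℚᵘ-/ i d) (toℚᵘ-/ (+ ℕ.suc d) 0) ⟩
  mkℚᵘ i d ℚᵘ.* mkℚᵘ (+ ℕ.suc d) 0                    ≈⟨ *≡* (trans (*-identityʳ (i * + ℕ.suc d)) (cong (λ n → i * + n) (sym (ℕ.*-identityʳ (ℕ.suc d))))) ⟩
  mkℚᵘ i 0                                            ≈⟨ toℚᵘ-/ i 0 ⟨
  toℚᵘ (i ℚ./ 1)                                      ∎)
  where open import Relation.Binary.Reasoning.Setoid ℚᵘ.≃-setoid

/<⇒ : ∀ i d x → i * ℚ.↧ x < ℚ.↥ x * + ℕ.suc d → i ℚ./ ℕ.suc d ℚ.< x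
/<⇒ i d x@record{} i<x = ℚ.toℚᵘ-cancel-< (ℚᵘ.<-respˡ-≃ (ℚᵘ.≃-sym (toℚᵘ-/ i d)) (ℚᵘ.*<* i<x))

</⇒ : ∀ i d x → ℚ.↥ x * + ℕ.suc d < i * ℚ.↧ x → x ℚ.< i ℚ./ ℕ.suc d
</⇒ i d x@record{} x<i = ℚ.toℚᵘ-cancel-< (ℚᵘ.<-respʳ-≃ (ℚᵘ.≃-sym (toℚᵘ-/ i d)) (ℚᵘ.*<* x<i))

ℕ→ℚ-pos : ∀ d → ℚ.Positive (ℕ→ℚ (ℕ.suc d))
ℕ→ℚ-pos d = ℚ.positive (</⇒ (+ ℕ.suc d) 0 0ℚ (+<+ (ℕ.s≤s ℕ.z≤n)))

-- The shift by 2 makes both a - 2 and a + 2 of the form j - 2 with j a natural number.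
threshold : ℕ → ℕ → ℚ
threshold j d = (+ j - 2ℤ) ℚ./ ℕ.suc d

-- For positive `d` the integer inequalities place `x` strictly between `(a - 2) / d` and
-- `(a + 2) / d`. These two thresholds then lie in the cuts of `ε`, and roundedness supplies
-- witnesses strictly beyond them.
dist<2-by-thresholds : ∀ ε x a d → a ℕ.< d ℕ.+ 2 →
  ℚ.↧ x * + a < ℚ.↥ x * + d + ℚ.↧ x * 2ℤ → ℚ.↥ x * + d < ℚ.↧ x * + a + ℚ.↧ x * 2ℤ →
  (∀ d′ → d ≡ ℕ.suc d′ → (threshold a d′ ℚ.< x → L ε (threshold a d′))
                       × (x ℚ.< threshold (4 ℕ.+ a) d′ → U ε (threshold (4 ℕ.+ a) d′))) →
  dist<2 a ε d
-- Both products vanish, so any members of the cuts will do; `a - 2 < 0` comes from `a<2`.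
dist<2-by-thresholds ε x a zero a<2 _ _ _ =
    (l , Ll , subst₂ ℚ._<_ (sym (/-+ (+ a) (- 2ℤ))) (sym (ℚ.*-zeroʳ l)) a-2<0)
  , (u , Uu , subst₂ ℚ._<_ (sym (ℚ.*-zeroʳ u)) (sym (/-+ (+ a) 2ℤ)) 0<a+2)
  where
  l u : ℚ
  l = proj₁ (L-inhabited ε)
  u = proj₁ (U-inhabited ε)
  Ll : L ε l
  Ll = proj₂ (L-inhabited ε)
  Uu : U ε u
  Uu = proj₂ (U-inhabited ε)
  below : ∀ a → + 2 - (1ℤ + a) ≡ 0ℤ * 1ℤ - (1ℤ + (a + - + 2) * 1ℤ)
  below = solve-∀
  above : ∀ a → a + 1ℤ ≡ (a + + 2) * 1ℤ - (1ℤ + 0ℤ * 1ℤ)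
  above = solve-∀
  a-2<0 : (+ a + - 2ℤ) ℚ./ 1 ℚ.< 0ℚ
  a-2<0 = /<⇒ (+ a + - 2ℤ) 0 0ℚ (<-by-slack (<⇒slack (+<+ a<2)) (below (+ a)))
  0<a+2 : 0ℚ ℚ.< (+ a + 2ℤ) ℚ./ 1
  0<a+2 = </⇒ (+ a + 2ℤ) 0 0ℚ
    (<-by-slack {d = + a + 1ℤ} (0≤-+ {+ a} {1ℤ} (+≤+ ℕ.z≤n) (+≤+ ℕ.z≤n)) (above (+ a)))
dist<2-by-thresholds ε x a (suc d) _ lo hi separate =
  let r , t<r , Lr = Equivalence.to (L-rounded ε (threshold a d)) (proj₁ (separate d refl) t<x)
      s , s<t , Us = Equivalence.to (U-rounded ε (threshold (4 ℕ.+ a) d)) (proj₂ (separate d refl) x<t)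
  in (r , Lr , subst (ℚ._< r ℚ.* ℕ→ℚ (ℕ.suc d)) lower-end (scale t<r))
   , (s , Us , subst (s ℚ.* ℕ→ℚ (ℕ.suc d) ℚ.<_) upper-end (scale s<t))
  where
  scale : ∀ {r s} → r ℚ.< s → r ℚ.* ℕ→ℚ (ℕ.suc d) ℚ.< s ℚ.* ℕ→ℚ (ℕ.suc d)
  scale = ℚ.*-monoˡ-<-pos (ℕ→ℚ (ℕ.suc d)) {{ℕ→ℚ-pos d}}
  below : ∀ p q a d → (p * d + q * (+ 2)) - (1ℤ + q * a) ≡ p * d - (1ℤ + (a - + 2) * q)
  below = solve-∀
  above : ∀ p q a d → (q * a + q * (+ 2)) - (1ℤ + p * d) ≡ ((+ 4 + a) - + 2) * q - (1ℤ + p * d)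
  above = solve-∀
  shift : ∀ a → (+ 4 + a) - + 2 ≡ a + + 2
  shift = solve-∀
  t<x : threshold a d ℚ.< x
  t<x = /<⇒ (+ a - 2ℤ) d x (<-by-slack (<⇒slack lo) (below (ℚ.↥ x) (ℚ.↧ x) (+ a) (+ ℕ.suc d)))
  x<t : x ℚ.< threshold (4 ℕ.+ a) d
  x<t = </⇒ (+ (4 ℕ.+ a) - 2ℤ) d x (<-by-slack (<⇒slack hi) (above (ℚ.↥ x) (ℚ.↧ x) (+ a) (+ ℕ.suc d)))
  lower-end : threshold a d ℚ.* ℕ→ℚ (ℕ.suc d) ≡ ℕ→ℚ a ℚ.- ℕ→ℚ 2
  lower-end = trans (/-*-cancel (+ a - 2ℤ) d) (sym (/-+ (+ a) (- 2ℤ)))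
  upper-end : threshold (4 ℕ.+ a) d ℚ.* ℕ→ℚ (ℕ.suc d) ≡ ℕ→ℚ a ℚ.+ ℕ→ℚ 2
  upper-end = trans (/-*-cancel (+ (4 ℕ.+ a) - 2ℤ) d)
    (trans (cong (ℚ._/ 1) (shift (+ a))) (sym (/-+ (+ a) 2ℤ)))

-- Even factors for a real ratio

module _ (ε : ℝ) (0≤ε : 0≤ ε) (ε≤1 : ≤1 ε) (G : Graph) where
  private
    S B : ℕ
    S = sumFin (nV G) (deg G)
    -- Degrees are at most `S` and the relevant `a` are below `2 + S`, so `4 + a` is below `6 + S`.
    B = 6 ℕ.+ S

  -- The list has to be fixed before the factor is known, so it covers every degree the factor may
  -- have. The entries 0 and 1 force the substitute into the unit interval.
  thresholds : List ℚ
  thresholds = 0ℚ ∷ 1ℚ ∷ cartesianProductWith threshold (upTo B) (upTo B)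

  module _ (x : ℚ) (separate : ∀ {t} → t ∈ thresholds → (t ℚ.< x → L ε t) × (x ℚ.< t → U ε t)) where

    substitute-nonNeg : 0ℤ ≤ ℚ.↥ x
    substitute-nonNeg = subst₂ _≤_ (*-zeroˡ (ℚ.↧ x)) (*-identityʳ (ℚ.↥ x)) (ℚ.drop-*≤* 0≤x)
      where
      0≤x : 0ℚ ℚ.≤ x
      0≤x = ℚ.≮⇒≥ λ x<0 → ℚ.<-irrefl refl (0≤ε 0ℚ (proj₂ (separate (here refl)) x<0))

    substitute-≤1 : ℚ.↥ x ≤ ℚ.↧ x
    substitute-≤1 = subst₂ _≤_ (*-identityʳ (ℚ.↥ x)) (*-identityˡ (ℚ.↧ x)) (ℚ.drop-*≤* x≤1)
      where
      x≤1 : x ℚ.≤ 1ℚ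
      x≤1 = ℚ.≮⇒≥ λ 1<x → ℚ.<-irrefl refl (ε≤1 1ℚ (proj₁ (separate (there (here refl))) 1<x))

    substitute-dist<2 : ∀ a v → ℚ.↧ x * + a < ℚ.↥ x * + deg G v + ℚ.↧ x * 2ℤ →
      ℚ.↥ x * + deg G v < ℚ.↧ x * + a + ℚ.↧ x * 2ℤ → dist<2 a ε (deg G v)
    substitute-dist<2 a v lo hi = dist<2-by-thresholds ε x a (deg G v) a<d+2 lo hi λ d′ d≡ →
        proj₁ (separate (∋-threshold a d′ (ℕ.≤-trans a<2+S (ℕ.m≤n+m (2 ℕ.+ S) 4)) (d′<B d≡)))
      , proj₂ (separate (∋-threshold (4 ℕ.+ a) d′ (ℕ.+-monoʳ-≤ 4 a<2+S) (d′<B d≡)))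
      where
      ∋-threshold : ∀ j d → j ℕ.< B → d ℕ.< B → threshold j d ∈ thresholds
      ∋-threshold j d j<B d<B = there (there (∈-cartesianProductWith⁺ threshold (∈-upTo⁺ j<B) (∈-upTo⁺ d<B)))
      -- The numerator of `x` is at most its denominator, so `lo` bounds the denominator times `a`
      -- by the denominator times `deg G v + 2`.
      a<d+2 : a ℕ.< deg G v ℕ.+ 2
      a<d+2 = drop‿+<+ (*-cancelˡ-<-nonNeg (ℚ.↧ x) (<-≤-trans lo
        (subst (ℚ.↥ x * + deg G v + ℚ.↧ x * 2ℤ ≤_) (sym (*-distribˡ-+ (ℚ.↧ x) (+ deg G v) 2ℤ))
          (+-monoˡ-≤ (ℚ.↧ x * 2ℤ) (*-monoʳ-≤-nonNeg (+ deg G v) substitute-≤1)))))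
      d≤S : deg G v ℕ.≤ S
      d≤S = drop‿+≤+ (subst (+ deg G v ≤_) (sym (+sumFin (nV G) (deg G))) (term≤sum (λ _ → +≤+ ℕ.z≤n) v))
      a<2+S : a ℕ.< 2 ℕ.+ S
      a<2+S = ℕ.≤-trans a<d+2 (subst (ℕ._≤ 2 ℕ.+ S) (ℕ.+-comm 2 (deg G v)) (ℕ.+-monoʳ-≤ 2 d≤S))
      d′<B : ∀ {d′} → deg G v ≡ ℕ.suc d′ → d′ ℕ.< B
      d′<B d≡ = ℕ.≤-trans (subst (ℕ._≤ S) d≡ d≤S) (ℕ.m≤n+m S 6)

    substitute⇒even-factor :
      (∃ λ (F : SpanningSubgraph G) → IsEvenFactor G F
        × (∀ v → ℚ.↧ x * + degIn G F v < ℚ.↥ x * + deg G v + ℚ.↧ x * 2ℤ)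
        × (∀ v → ℚ.↥ x * + deg G v < ℚ.↧ x * + degIn G F v + ℚ.↧ x * 2ℤ)) →
      Σ (SpanningSubgraph G) λ F → IsEvenFactor G F × (∀ v → dist<2 (degIn G F v) ε (deg G v))
    substitute⇒even-factor (F , F-even , lo , hi) =
      F , F-even , λ v → substitute-dist<2 (degIn G F v) v (lo v) (hi v)

  even-factor : (∀ v → Even (deg G v)) →
    (∃ λ x → ∀ {t} → t ∈ thresholds → (t ℚ.< x → L ε t) × (x ℚ.< t → U ε t)) →
    Σ (SpanningSubgraph G) λ F → IsEvenFactor G F × (∀ v → dist<2 (degIn G F v) ε (deg G v))
  even-factor even (x , separate) = substitute⇒even-factor x separate
    (rational-even-factor G even (ℚ.↥ x) (ℚ.↧ₙ x) (substitute-nonNeg x separate) (substitute-≤1 x separate))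

theorem1p8 : (ε : ℝ) → 0≤ ε → ≤1 ε → (G : Graph) → (∀ v → Even (deg G v)) →
    Σ (SpanningSubgraph G) (λ F → IsEvenFactor G F × (∀ v → dist<2 (degIn G F v) ε (deg G v)))
theorem1p8 ε 0≤ε ε≤1 G even =
  even-factor ε 0≤ε ε≤1 G even (rational-substitute ε (thresholds ε 0≤ε ε≤1 G))
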